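{- There is an algorithm that, for any graph $G$ on $n$ vertices that has minimum degree $\delta$, produces a burning sequence (burning all vertices of $G$) with length at most $\left\lceil \sqrt{\frac{24n}{\delta+1}}\ \right\rceil$.
   Context: Graphs are finite, simple, undirected and unweighted; $d(u,v)$ denotes the length of a shortest path between $u$ and $v$. Burning process: it takes place in synchronous rounds $1,2,\dots$. In each round $i$, every vertex having a neighbour that was burned in an earlier round becomes burned, and additionally one chosen vertex $a_i$ (the activator of round $i$) becomes burned; burned vertices stay burned. A burning sequence (specified by a burning schedule) of length $m$ is a sequence $\langle a_1,\dots,a_m\rangle$ of activators, where $a_i$ is the activator of round $i$; it burns $G$ (completes in $m$ rounds) if all vertices are burned by the end of round $m$, equivalently if every vertex $v$ satisfies $d(v,a_i)\le m-i$ for some $i\in\{1,\dots,m\}$. The degree of a vertex is the number of edges incident to it, and the minimum degree of $G$ is the minimum vertex degree taken over all vertices of $G$.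
   Formalization: The graph is assumed to be connected; without this the claim fails, for example for 100 isolated vertices (δ = 0), which need 100 rounds while the bound is ⌈√2400⌉ = 49. -}

module Defs where

open import Data.Bool using (Bool; T; false)
open import Data.Fin using (Fin; toℕ)
open import Data.Fin.Subset using (Subset; ∣_∣)
open import Data.Integer as ℤ using (+_; -[1+_])
import Data.Integer.Properties as ℤ
open import Data.List using (List; length; lookup)
open import Data.Nat using (ℕ; zero; suc; _+_; _*_; _≤_; z≤n)
open import Data.Nat.Properties
  using (+-identityʳ; +-suc; m≤m*n; ≤-trans; ≤∧≢⇒<)
open import Data.Product using (∃; _×_)
open import Data.Rational.Unnormalised as ℚ using (ℚᵘ; mkℚᵘ; ↥_)
import Data.Rational.Unnormalised.Properties as ℚ
open import Data.Vec using (tabulate)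
open import Relation.Binary.Construct.Closure.ReflexiveTransitive using (Star)
open import Relation.Binary.PropositionalEquality
  using (_≡_; _≢_; refl; subst)
open import Relation.Nullary using (yes; no; contradiction)

record Graph (n : ℕ) : Set where
  field
    adjacent     : Fin n → Fin n → Bool
    adjacent-sym : ∀ u v → adjacent u v ≡ adjacent v u
    loopless     : ∀ v → adjacent v v ≡ false

module _ {n : ℕ} (G : Graph n) where
  open Graph G

  Adj : Fin n → Fin n → Set
  Adj u v = T (adjacent u v)

  Connected : Set
  Connected = ∀ u v → Star Adj u v

  neighbours : Fin n → Subset n
  neighbours v = tabulate (adjacent v)

  degree : Fin n → ℕ
  degree v = ∣ neighbours v ∣

  -- No δ satisfies this on the graph with no vertices.
  IsMinDegree : ℕ → Set
  IsMinDegree δ = (∃ λ v → degree v ≡ δ) × (∀ v → δ ≤ degree v)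

  -- BurnedBy as t v: the process with activators as has burned v by the end
  -- of round t.  Rounds count from 1, list positions from 0.
  data BurnedBy (as : List (Fin n)) : ℕ → Fin n → Set where
    activated : ∀ i → BurnedBy as (suc (toℕ i)) (lookup as i)
    spread    : ∀ {t u v} → BurnedBy as t u → Adj u v → BurnedBy as (suc t) v
    stays     : ∀ {t v} → BurnedBy as t v → BurnedBy as (suc t) v

  Burns : List (Fin n) → Set
  Burns as = ∀ v → BurnedBy as (length as) v

infix 8 _²

_² : ℕ → ℚᵘ
k ² = + (k * k) ℚ./ 1

private
  search : ℚᵘ → ℕ → ℕ → ℕ
  search x zero       k = k
  search x (suc fuel) k with x ℚ.≤? k ²
  ... | yes _ = k
  ... | no  _ = search x fuel (suc k)

-- ⌈√ x ⌉ is the least natural k with x ≤ k², which for x ≥ 0 is the ceiling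
-- of the real square root of x.  The numerator of x bounds the search.
⌈√_⌉ : ℚᵘ → ℕ
⌈√ x ⌉ = search x ℤ.∣ ↥ x ∣ 0

private
  search-upper : ∀ x fuel k → x ℚ.≤ (k + fuel) ² → x ℚ.≤ search x fuel k ²
  search-upper x zero       k h = subst (λ j → x ℚ.≤ j ²) (+-identityʳ k) h
  search-upper x (suc fuel) k h with x ℚ.≤? k ²
  ... | yes p = p
  ... | no  _ =
    search-upper x fuel (suc k) (subst (λ j → x ℚ.≤ j ²) (+-suc k fuel) h)

  search-least : ∀ x fuel k j → k ≤ j → x ℚ.≤ j ² → search x fuel k ≤ j
  search-least x zero       k j k≤j h = k≤j
  search-least x (suc fuel) k j k≤j h with x ℚ.≤? k ²
  ... | yes _ = k≤j
  ... | no ¬p = search-least x fuel (suc k) j (≤∧≢⇒< k≤j k≢j) h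
    where
    k≢j : k ≢ j
    k≢j refl = contradiction h ¬p

  m≤m*m : ∀ m → m ≤ m * m
  m≤m*m zero    = z≤n
  m≤m*m (suc m) = m≤m*n (suc m) (suc m)

  numerator-enough : ∀ x → x ℚ.≤ ℤ.∣ ↥ x ∣ ²
  numerator-enough (mkℚᵘ (+ p) d) = ℚ.*≤* (begin
    + p ℤ.* + 1            ≡⟨ ℤ.*-identityʳ (+ p) ⟩
    + p                    ≤⟨ ℤ.+≤+ (≤-trans (m≤m*m p) (m≤m*n (p * p) (suc d))) ⟩
    + (p * p * suc d)      ≡⟨ ℤ.pos-* (p * p) (suc d) ⟩
    + (p * p) ℤ.* + suc d  ∎)
    where open ℤ.≤-Reasoning
  numerator-enough (mkℚᵘ -[1+ p ] d) = ℚ.*≤* ℤ.-≤+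

⌈√⌉-upper : ∀ x → x ℚ.≤ ⌈√ x ⌉ ²
⌈√⌉-upper x = search-upper x ℤ.∣ ↥ x ∣ 0 (numerator-enough x)

⌈√⌉-least : ∀ x k → x ℚ.≤ k ² → ⌈√ x ⌉ ≤ k
⌈√⌉-least x k = search-least x ℤ.∣ ↥ x ∣ 0 k z≤n

{-# OPTIONS --safe #-}
module Submission where

-- Take a maximal set of centres pairwise more than r = 6q + 2 apart, activate
-- them one after another and wait r more rounds.  If there are at least two
-- centres, a path leaving a centre c meets every sphere around c of radius
-- 3i, i ≤ q; one point of each of these spheres, for each centre, gives points
-- pairwise more than 2 apart.  Their closed neighbourhoods are disjoint, so p
-- centres satisfy p (q + 1) (δ + 1) ≤ n.  For the bound k of the theorem this
-- reads 24 p (q + 1) ≤ k², and q = ⌊(k - 5) / 12⌋ gives p + r ≤ k.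

open import Defs
open import Data.Bool using (T)
open import Data.Bool.Properties using (T?; T-≡)
open import Data.Fin using (Fin; zero; suc; toℕ)
open import Data.Fin.Properties using (any?; toℕ≤pred[n])
import Data.Fin.Properties as Fin
open import Data.Fin.Subset using
  (Subset; inside; outside; ∣_∣; _∈_; _∪_; _∩_; ⁅_⁆; ⋃; Empty)
open import Data.Fin.Subset.Properties using
  (∣p∣≤n; ∣⁅x⁆∣≡1; x∈⁅y⁆⇒x≡y; x∈p∩q⁺; x∈p∩q⁻; x∈p∪q⁻; ∉⊥; drop-∷-Empty)
open import Data.Integer as ℤ using (+_)
import Data.Integer.Properties as ℤ
open import Data.List using
  (List; []; _∷_; _++_; length; lookup; map; allFin; replicate; tabulate)
open import Data.List.Extrema.Nat using (min; min≈v⁺)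
open import Data.List.Membership.Propositional.Properties using (∈-allFin; ∈-map⁺)
open import Data.List.Properties using
  (length-++; length-map; length-replicate; length-tabulate)
open import Data.List.Relation.Unary.All as All using (All; []; _∷_)
import Data.List.Relation.Unary.All.Properties as All
open import Data.List.Relation.Unary.AllPairs as AllPairs using (AllPairs; []; _∷_)
import Data.List.Relation.Unary.AllPairs.Properties as AllPairs
open import Data.List.Relation.Unary.Any as Any using (Any; here; there)
open import Data.Nat using
  (ℕ; zero; suc; _+_; _*_; _∸_; _≤_; _<_; _≤′_; ≤′-refl; ≤′-step; z≤n; s≤s; z<s; s<s)
open import Data.Nat.DivMod using (_%_; m≡m%n+[m/n]*n; m%n<n) renaming (_/_ to _div_)
open import Data.Nat.Properties
open import Data.Nat.Tactic.RingSolver using (solve-∀)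
open import Data.Product using (Σ-syntax; ∃; _×_; _,_; proj₁; proj₂)
open import Data.Rational.Unnormalised using (_/_)
open import Data.Rational.Unnormalised.Properties using (drop-*≤*)
open import Data.Sum using (inj₁; inj₂)
open import Data.Vec using ([]; _∷_)
open import Data.Vec.Properties using ([]=⇒lookup; lookup∘tabulate)
open import Function using (_∘_)
open import Function.Bundles using (Equivalence)
open import Relation.Binary.Construct.Closure.ReflexiveTransitive using (Star; ε; _◅_)
open import Relation.Binary.PropositionalEquality
open import Relation.Nullary using (¬_; Dec; yes; no; contradiction)
open import Relation.Nullary.Decidable using (map′; _⊎-dec_; _×-dec_)

-- Cardinalities of disjoint subsets.

Disjoint : ∀ {n} → Subset n → Subset n → Set
Disjoint p q = Empty (p ∩ q)

disjoint⇒∣p∪q∣≡∣p∣+∣q∣ : ∀ {n} (p q : Subset n) → Disjoint p q →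
                        ∣ p ∪ q ∣ ≡ ∣ p ∣ + ∣ q ∣
disjoint⇒∣p∪q∣≡∣p∣+∣q∣ []            []            d = refl
disjoint⇒∣p∪q∣≡∣p∣+∣q∣ (inside  ∷ p) (inside  ∷ q) d =
  contradiction (zero , Data.Vec.here) d
disjoint⇒∣p∪q∣≡∣p∣+∣q∣ (inside  ∷ p) (outside ∷ q) d =
  cong suc (disjoint⇒∣p∪q∣≡∣p∣+∣q∣ p q (drop-∷-Empty d))
disjoint⇒∣p∪q∣≡∣p∣+∣q∣ (outside ∷ p) (inside  ∷ q) d =
  trans (cong suc (disjoint⇒∣p∪q∣≡∣p∣+∣q∣ p q (drop-∷-Empty d)))
        (sym (+-suc ∣ p ∣ ∣ q ∣))
disjoint⇒∣p∪q∣≡∣p∣+∣q∣ (outside ∷ p) (outside ∷ q) d =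
  disjoint⇒∣p∪q∣≡∣p∣+∣q∣ p q (drop-∷-Empty d)

disjoint-⋃ : ∀ {n} {p : Subset n} {ps} → All (Disjoint p) ps → Disjoint p (⋃ ps)
disjoint-⋃ {p = p} {[]} [] (x , x∈) = ∉⊥ (proj₂ (x∈p∩q⁻ p _ x∈))
disjoint-⋃ {p = p} {q ∷ ps} (d ∷ ds) (x , x∈) with x∈p∩q⁻ p _ x∈
... | x∈p , x∈⋃ with x∈p∪q⁻ q (⋃ ps) x∈⋃
...   | inj₁ x∈q = d (x , x∈p∩q⁺ (x∈p , x∈q))
...   | inj₂ x∈r = disjoint-⋃ ds (x , x∈p∩q⁺ (x∈p , x∈r))

disjoint⇒length*m≤∣⋃∣ : ∀ {n m} {ps : List (Subset n)} → AllPairs Disjoint ps →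
                       All (λ p → m ≤ ∣ p ∣) ps → length ps * m ≤ ∣ ⋃ ps ∣
disjoint⇒length*m≤∣⋃∣ [] [] = z≤n
disjoint⇒length*m≤∣⋃∣ {m = m} {p ∷ ps} (d ∷ ds) (b ∷ bs) = begin
  m + length ps * m   ≤⟨ +-mono-≤ b (disjoint⇒length*m≤∣⋃∣ ds bs) ⟩
  ∣ p ∣ + ∣ ⋃ ps ∣    ≡⟨ disjoint⇒∣p∪q∣≡∣p∣+∣q∣ p (⋃ ps) (disjoint-⋃ d) ⟨
  ∣ p ∪ ⋃ ps ∣        ∎
  where open ≤-Reasoning

-- This is 6q + 2, bracketed as the length of a walk from one centre to its sphere point, on by at
-- most 2 to another sphere point, and from there to the second centre. `within-trans` yields
-- exactly this index in `cross`.
radius : ℕ → ℕ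
radius q = q * 3 + (2 + q * 3)

-- Bounded distance in a graph.

module _ {n : ℕ} (G : Graph n) where
  open Graph G

  -- A walk of at most r edges, padded by `stay` and extended at its far end. `stay` and `step`
  -- parallel `stays` and `spread` of `BurnedBy`, so fire follows a walk rule by rule.
  data Within : ℕ → Fin n → Fin n → Set where
    done : ∀ {u} → Within 0 u u
    stay : ∀ {r u v} → Within r u v → Within (suc r) u v
    step : ∀ {r u v w} → Within r u v → Adj G v w → Within (suc r) u w

  Far : ℕ → Fin n → Fin n → Set
  Far r u v = ¬ Within r u v

  within? : ∀ r u v → Dec (Within r u v)
  within? zero    u v = map′ (λ { refl → done }) (λ { done → refl }) (u Fin.≟ v)
  within? (suc r) u v = map′
    (λ { (inj₁ p) → stay p ; (inj₂ (_ , p , e)) → step p e })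
    (λ { (stay p) → inj₁ p ; (step p e) → inj₂ (_ , p , e) })
    (within? r u v ⊎-dec any? λ w → within? r u w ×-dec T? (adjacent w v))

  adj-sym : ∀ {u v} → Adj G u v → Adj G v u
  adj-sym {u} {v} = subst T (adjacent-sym u v)

  within-refl : ∀ r {u} → Within r u u
  within-refl zero    = done
  within-refl (suc r) = stay (within-refl r)

  within-mono : ∀ {r s u v} → r ≤ s → Within r u v → Within s u v
  within-mono = go ∘ ≤⇒≤′
    where
    go : ∀ {r s u v} → r ≤′ s → Within r u v → Within s u v
    go ≤′-refl     p = p
    go (≤′-step l) p = stay (go l p)

  within-trans : ∀ {r s u v w} → Within s v w → Within r u v → Within (s + r) u w
  within-trans done       p = p
  within-trans (stay q)   p = stay (within-trans q p)
  within-trans (step q e) p = step (within-trans q p) e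

  within-sym : ∀ {r u v} → Within r u v → Within r v u
  within-sym done = done
  within-sym (stay p) = stay (within-sym p)
  within-sym {suc r} {u} {v} (step p e) =
    -- The last edge, reversed, becomes a first leg of length 1, so the index comes out as r + 1.
    subst (λ s → Within s v u) (+-comm r 1)
      (within-trans (within-sym p) (step done (adj-sym e)))

  -- Spheres.

  record OnSphere (r : ℕ) (c x : Fin n) : Set where
    field
      within : Within r c x
      far    : ∀ {s} → s < r → Far s c x
  open OnSphere

  -- Follow the path until it first leaves the ball of radius r. The vertex reached there is
  -- adjacent to a vertex of the ball, so its distance from the centre is exactly r + 1.
  sphere-nonempty : ∀ r {c w} → Star (Adj G) c w → Far r c w → ∃ (OnSphere r c)
  sphere-nonempty zero    {c} path f = c , record { within = done ; far = λ () }
  sphere-nonempty (suc r) path f = leave (within-refl r) path (f ∘ stay)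
    where
    leave : ∀ {c u w} → Within r c u → Star (Adj G) u w → Far r c w →
            ∃ (OnSphere (suc r) c)
    leave p ε f = contradiction p f
    leave {c} p (_◅_ {j = v} e path) f with within? r c v
    ... | yes p′ = leave p′ path f
    ... | no ¬p′ = v , record
      { within = step p e
      ; far    = λ { (s≤s s≤r) → ¬p′ ∘ within-mono s≤r }
      }

  -- Closed neighbourhoods and the packing bound.

  closedNeighbourhood : Fin n → Subset n
  closedNeighbourhood v = ⁅ v ⁆ ∪ neighbours G v

  ∈-neighbours⇒Adj : ∀ {v x} → x ∈ neighbours G v → Adj G v x
  ∈-neighbours⇒Adj {v} {x} x∈ = Equivalence.from T-≡
    (trans (sym (lookup∘tabulate (adjacent v) x)) ([]=⇒lookup x∈))

  ∈-closedNeighbourhood⇒Within : ∀ {v x} → x ∈ closedNeighbourhood v → Within 1 v x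
  ∈-closedNeighbourhood⇒Within {v} x∈ with x∈p∪q⁻ ⁅ v ⁆ (neighbours G v) x∈
  ... | inj₁ x∈v with refl ← x∈⁅y⁆⇒x≡y v x∈v = stay done
  ... | inj₂ x∈N = step done (∈-neighbours⇒Adj x∈N)

  -- `loopless` keeps v out of `neighbours G v`, so the union is disjoint.
  ∣closedNeighbourhood∣ : ∀ v → ∣ closedNeighbourhood v ∣ ≡ suc (degree G v)
  ∣closedNeighbourhood∣ v = trans
    (disjoint⇒∣p∪q∣≡∣p∣+∣q∣ ⁅ v ⁆ (neighbours G v) disjoint)
    (cong (_+ degree G v) (∣⁅x⁆∣≡1 v))
    where
    disjoint : Disjoint ⁅ v ⁆ (neighbours G v)
    disjoint (x , x∈) with x∈p∩q⁻ ⁅ v ⁆ (neighbours G v) x∈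
    ... | x∈v , x∈N with refl ← x∈⁅y⁆⇒x≡y v x∈v =
      subst T (loopless v) (∈-neighbours⇒Adj x∈N)

  -- A common vertex would join the two by a walk of length at most 2.
  far⇒disjoint : ∀ {u v} → Far 2 u v →
                 Disjoint (closedNeighbourhood u) (closedNeighbourhood v)
  far⇒disjoint {u} {v} f (x , x∈)
    with x∈p∩q⁻ (closedNeighbourhood u) (closedNeighbourhood v) x∈
  ... | x∈u , x∈v = f (within-trans
    (within-sym (∈-closedNeighbourhood⇒Within x∈v))
    (∈-closedNeighbourhood⇒Within x∈u))

  packing : ∀ {δ xs} → (∀ v → δ ≤ degree G v) → AllPairs (Far 2) xs →
            length xs * suc δ ≤ n
  packing {δ} {xs} δ≤ far = begin
    length xs * suc δ                            ≡⟨ cong (_* suc δ) (length-map closedNeighbourhood xs) ⟨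
    length (map closedNeighbourhood xs) * suc δ  ≤⟨ disjoint⇒length*m≤∣⋃∣
                                                      (AllPairs.map⁺ (AllPairs.map far⇒disjoint far))
                                                      (All.map⁺ (All.universal large xs)) ⟩
    ∣ ⋃ (map closedNeighbourhood xs) ∣           ≤⟨ ∣p∣≤n (⋃ (map closedNeighbourhood xs)) ⟩
    n                                            ∎
    where
    open ≤-Reasoning
    large : ∀ v → suc δ ≤ ∣ closedNeighbourhood v ∣
    large v = ≤-trans (s≤s (δ≤ v)) (≤-reflexive (sym (∣closedNeighbourhood∣ v)))

  -- Sphere points around separated centres.

  -- This is why the radii are spaced by 3: a walk of length 2 from x would put y within 3i + 2 of
  -- c, which is less than 3j.
  spheres-far : ∀ {c x y i j} → i < j →
                OnSphere (i * 3) c x → OnSphere (j * 3) c y → Far 2 x y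
  spheres-far i<j x y p = far y (*-monoˡ-≤ 3 i<j) (within-trans p (within x))

  module _ (connected : Connected G) (q : ℕ) where

    Escapes : Fin n → Set
    Escapes c = ∃ (Far (q * 3) c)

    sphere-points : ∀ {c} → Escapes c →
      Σ[ xs ∈ List (Fin n) ] length xs ≡ suc q × AllPairs (Far 2) xs × All (Within (q * 3) c) xs
    sphere-points {c} (w , f) =
      tabulate (proj₁ ∘ point) , length-tabulate (proj₁ ∘ point) ,
      AllPairs.tabulate⁺-< (λ {i} {j} i<j →
        spheres-far i<j (proj₂ (point i)) (proj₂ (point j))) ,
      All.tabulate⁺ λ i → within-mono (i*3≤ i) (within (proj₂ (point i)))
      where
      i*3≤ : ∀ (i : Fin (suc q)) → toℕ i * 3 ≤ q * 3
      i*3≤ i = *-monoˡ-≤ 3 (toℕ≤pred[n] i)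
      point : ∀ (i : Fin (suc q)) → ∃ (OnSphere (toℕ i * 3) c)
      point i = sphere-nonempty _ (connected c w) (f ∘ within-mono (i*3≤ i))

    -- Points of one centre are separated by their radii. For different centres, two points within 2
    -- of each other would bring the centres within `radius q`. The `Any` component remembers a
    -- centre near each point for this argument.
    all-sphere-points : ∀ {cs} → All Escapes cs → AllPairs (Far (radius q)) cs →
      Σ[ xs ∈ List (Fin n) ] length xs ≡ length cs * suc q × AllPairs (Far 2) xs ×
        All (λ x → Any (λ c → Within (q * 3) c x) cs) xs
    all-sphere-points [] [] = [] , refl , [] , []
    all-sphere-points (e ∷ es) (f ∷ fs)
      with xs , ∣xs∣ , xs-far , xs-near ← sphere-points e
         | ys , ∣ys∣ , ys-far , ys-near ← all-sphere-points es fs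
      = xs ++ ys
      , trans (length-++ xs) (cong₂ _+_ ∣xs∣ ∣ys∣)
      , AllPairs.++⁺ xs-far ys-far
          (All.map (λ p → All.map (λ {y} → cross p f) ys-near) xs-near)
      , All.++⁺ (All.map here xs-near) (All.map there ys-near)
      where
      cross : ∀ {c cs x y} → Within (q * 3) c x → All (Far (radius q) c) cs →
              Any (λ d → Within (q * 3) d y) cs → Far 2 x y
      cross p (f ∷ _)  (here p′) b = f (within-trans (within-sym p′) (within-trans b p))
      cross p (_ ∷ fs) (there a) b = cross p fs a b

  -- Greedy nets.

  net : ℕ → List (Fin n) → List (Fin n)
  net r []       = []
  net r (v ∷ vs) with Any.any? (λ c → within? r c v) (net r vs)
  ... | yes _ = net r vs
  ... | no  _ = v ∷ net r vs

  net-far : ∀ r vs → AllPairs (Far r) (net r vs)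
  net-far r []       = []
  net-far r (v ∷ vs) with Any.any? (λ c → within? r c v) (net r vs)
  ... | yes _ = net-far r vs
  ... | no ¬p = All.map (_∘ within-sym) (All.¬Any⇒All¬ _ ¬p) ∷ net-far r vs

  -- A vertex is passed over only when a chosen centre is already near it; otherwise it becomes a
  -- centre itself. Separation and covering come from the same test.
  net-near : ∀ r vs → All (λ v → Any (λ c → Within r c v) (net r vs)) vs
  net-near r []       = []
  net-near r (v ∷ vs) with Any.any? (λ c → within? r c v) (net r vs)
  ... | yes p = p ∷ net-near r vs
  ... | no  _ = here (within-refl r) ∷ All.map there (net-near r vs)

  -- Burning from a net.

  -- The last r rounds only let the fire spread; their activator is arbitrary.
  thenWait : ℕ → List (Fin n) → List (Fin n)
  thenWait r []       = []
  thenWait r (c ∷ cs) = (c ∷ cs) ++ replicate r c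

  length-thenWait : ∀ r cs → length (thenWait r cs) ≤ length cs + r
  length-thenWait r []       = z≤n
  length-thenWait r (c ∷ cs) = ≤-reflexive
    (trans (length-++ (c ∷ cs)) (cong (λ s → suc (length cs + s)) (length-replicate r)))

  burned-mono : ∀ {as s t v} → s ≤ t → BurnedBy G as s v → BurnedBy G as t v
  burned-mono = go ∘ ≤⇒≤′
    where
    go : ∀ {as s t v} → s ≤′ t → BurnedBy G as s v → BurnedBy G as t v
    go ≤′-refl     b = b
    go (≤′-step l) b = stays (go l b)

  burned-within : ∀ {as r t u v} → BurnedBy G as t u → Within r u v → BurnedBy G as (r + t) v
  burned-within b done       = b
  burned-within b (stay p)   = stays (burned-within b p)
  burned-within b (step p e) = spread (burned-within b p) e

  any-position : ∀ {P : Fin n → Set} {cs ds} → Any P cs →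
                 Σ[ i ∈ Fin (length (cs ++ ds)) ] toℕ i < length cs × P (lookup (cs ++ ds) i)
  any-position (here p)  = zero , z<s , p
  any-position (there a) with i , i< , p ← any-position a = suc i , s<s i< , p

  -- The centre at position i is activated in round i + 1, which is at most the number of centres,
  -- so at least r further rounds remain for its fire to spread.
  burns-thenWait : ∀ r {cs} → (∀ v → Any (λ c → Within r c v) cs) → Burns G (thenWait r cs)
  burns-thenWait r {[]}     near v = contradiction (near v) λ ()
  burns-thenWait r {c ∷ cs} near v with i , i< , p ← any-position {ds = replicate r c} (near v) =
    burned-mono (begin
      r + suc (toℕ i)                           ≤⟨ +-monoʳ-≤ r i< ⟩
      r + length (c ∷ cs)                       ≡⟨ cong (_+ length (c ∷ cs)) (length-replicate r) ⟨
      length (replicate r c) + length (c ∷ cs)  ≡⟨ +-comm (length (replicate r c)) _ ⟩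
      length (c ∷ cs) + length (replicate r c)  ≡⟨ length-++ (c ∷ cs) ⟨
      length ((c ∷ cs) ++ replicate r c)        ∎)
    (burned-within (activated i) p)
    where open ≤-Reasoning

  -- The algorithm.

  -- The algorithm receives only the graph and has to compute δ. The default n is safe because no
  -- degree exceeds it.
  minDegree : ℕ
  minDegree = min n (map (degree G) (allFin n))

  minDegree-correct : ∀ {δ} → IsMinDegree G δ → minDegree ≡ δ
  minDegree-correct ((v , refl) , δ≤) =
    min≈v⁺ (∈-map⁺ (degree G) (∈-allFin v))
           (All.map⁺ (All.universal δ≤ (allFin n)))
           (∣p∣≤n (neighbours G v))

  burningSequence : ℕ → List (Fin n)
  burningSequence q = thenWait (radius q) (net (radius q) (allFin n))

  burningSequence-burns : ∀ q → Burns G (burningSequence q)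
  burningSequence-burns q =
    burns-thenWait (radius q) λ v → All.lookup (net-near (radius q) (allFin n)) (∈-allFin v)

  -- Each centre has another one as its distant vertex: the second serves the first, and the first
  -- serves all others.
  far-pairs⇒escapes : ∀ q {c d cs} → AllPairs (Far (radius q)) (c ∷ d ∷ cs) →
                      All (λ u → ∃ (Far (q * 3) u)) (c ∷ d ∷ cs)
  far-pairs⇒escapes q {c} {d} (fs@(f ∷ _) ∷ _) =
    (d , shrink f) ∷ All.map (λ g → c , shrink (g ∘ within-sym)) fs
    where
    shrink : ∀ {u v} → Far (radius q) u v → Far (q * 3) u v
    shrink = _∘ within-mono (m≤m+n (q * 3) _)

-- Arithmetic of the bound.

bound : ℕ → ℕ → ℕ
bound n δ = ⌈√ (+ (24 * n) / suc δ) ⌉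

-- With q near k/12 the two costs balance: the packing bound k²/(24(q + 1)) on the number of centres
-- and the radius 6q + 2 are both about k/2.
scale : ℕ → ℕ
scale k = (k ∸ 5) div 12

-- The defining upper inequality of `⌈√_⌉`, with the denominators 1 and δ + 1 cleared.
24n≤k²[1+δ] : ∀ n δ → 24 * n ≤ bound n δ * bound n δ * suc δ
24n≤k²[1+δ] n δ = ℤ.drop‿+≤+ (subst₂ ℤ._≤_
  (ℤ.*-identityʳ (+ (24 * n))) (sym (ℤ.pos-* (k * k) (suc δ)))
  (drop-*≤* (⌈√⌉-upper (+ (24 * n) / suc δ))))
  where k = bound n δ

packed⇒24m≤k² : ∀ {n δ} m → m * suc δ ≤ n → 24 * m ≤ bound n δ * bound n δ
packed⇒24m≤k² {n} {δ} m packed = *-cancelʳ-≤ (24 * m) (k * k) (suc δ) (begin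
  24 * m * suc δ    ≡⟨ *-assoc 24 m (suc δ) ⟩
  24 * (m * suc δ)  ≤⟨ *-monoʳ-≤ 24 packed ⟩
  24 * n            ≤⟨ 24n≤k²[1+δ] n δ ⟩
  k * k * suc δ     ∎)
  where
  open ≤-Reasoning
  k = bound n δ

24≤k²⇒5≤k : ∀ {k} → 24 ≤ k * k → 5 ≤ k
-- If k were at most 4, then k² would be below 17 = 4² + 1, while 17 + 7 = 24.
24≤k²⇒5≤k 24≤k² = ≰⇒> λ k≤4 → <⇒≱ (s≤s (*-mono-≤ k≤4 k≤4)) (≤-trans (m≤m+n 17 7) 24≤k²)

scale-spec : ∀ {k} → 5 ≤ k → Σ[ u ∈ ℕ ] u < 12 × k ≡ 5 + (u + scale k * 12)
scale-spec {k} 5≤k = (k ∸ 5) % 12 , m%n<n (k ∸ 5) 12 ,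
  trans (sym (m+[n∸m]≡n 5≤k)) (cong (_+_ 5) (m≡m%n+[m/n]*n (k ∸ 5) 12))

-- The hypothesis fails already for p = 6q + 4 + u, because u² ≤ 11u.
centres+radius≤k : ∀ p q u → u < 12 → let k = 5 + (u + q * 12) in
                   24 * (p * suc q) ≤ k * k → p + radius q ≤ k
centres+radius≤k p q u (s≤s u≤11) few = ≮⇒≥ λ k< → <-irrefl refl (begin-strict
  24 * (p₀ * suc q)                     ≤⟨ *-monoʳ-≤ 24 (*-monoˡ-≤ (suc q) (many k<)) ⟩
  24 * (p * suc q)                      ≤⟨ few ⟩
  k * k                                 ≡⟨ square q u ⟩
  u * u + rest                          ≤⟨ +-monoˡ-≤ rest (*-monoˡ-≤ u u≤11) ⟩
  11 * u + rest                         <⟨ m<m+n (11 * u + rest) z<s ⟩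
  11 * u + rest + (71 + (120 * q + 3 * u))  ≡⟨ product q u ⟨
  24 * (p₀ * suc q)                     ∎)
  where
  open ≤-Reasoning
  k = 5 + (u + q * 12)
  -- This is k + 1 minus `radius q`, the least number of centres that would break the claim. `rest`
  -- is k² minus u².
  p₀ = 4 + (u + q * 6)
  rest = 144 * (q * q) + 24 * (q * (5 + u)) + (25 + 10 * u)
  square : ∀ q u → (5 + (u + q * 12)) * (5 + (u + q * 12)) ≡
    u * u + (144 * (q * q) + 24 * (q * (5 + u)) + (25 + 10 * u))
  square = solve-∀
  product : ∀ q u → 24 * ((4 + (u + q * 6)) * suc q) ≡
    11 * u + (144 * (q * q) + 24 * (q * (5 + u)) + (25 + 10 * u)) + (71 + (120 * q + 3 * u))
  product = solve-∀
  split : ∀ q u → suc (5 + (u + q * 12)) ≡ 4 + (u + q * 6) + (q * 3 + (2 + q * 3))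
  split = solve-∀
  many : k < p + radius q → p₀ ≤ p
  many k< = +-cancelʳ-≤ (radius q) p₀ p (subst (_≤ p + radius q) (split q u) k<)

-- Serves the case of a single centre, where no second centre forces a path through the spheres.
1+radius≤k : ∀ q u → 1 + radius q ≤ 5 + (u + q * 12)
1+radius≤k q u = subst (1 + radius q ≤_) (split q u) (m≤m+n (1 + radius q) _)
  where
  split : ∀ q u → 1 + (q * 3 + (2 + q * 3)) + (2 + (u + q * 6)) ≡ 5 + (u + q * 12)
  split = solve-∀

-- The length of the schedule.

separated⇒length+radius≤k : ∀ {n δ} (G : Graph n) → Connected G → IsMinDegree G δ →
  let k = bound n δ; q = scale k in
  ∀ {cs} → AllPairs (Far G (radius q)) cs → length cs + radius q ≤ k
separated⇒length+radius≤k {n} {δ} G connected ((v , _) , δ≤) {cs} far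
  -- Packing the single vertex v gives δ + 1 ≤ n, hence 24 ≤ k² and 5 ≤ k, so the truncated
  -- subtraction in `scale` is exact.
  with u , u<12 , k≡ ← scale-spec (24≤k²⇒5≤k
         (packed⇒24m≤k² 1 (packing G {xs = v ∷ []} δ≤ ([] ∷ []))))
  = subst (length cs + radius q ≤_) (sym k≡) (go cs far)
  where
  k = bound n δ
  q = scale k
  go : ∀ cs → AllPairs (Far G (radius q)) cs → length cs + radius q ≤ 5 + (u + q * 12)
  go []           far = ≤-trans (n≤1+n _) (1+radius≤k q u)
  go (_ ∷ [])     far = 1+radius≤k q u
  go cs@(_ ∷ _ ∷ _) far
    with xs , ∣xs∣ , xs-far , _ ← all-sphere-points G connected q (far-pairs⇒escapes G q far) far
    = centres+radius≤k (length cs) q u u<12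
        (subst (λ j → 24 * (length cs * suc q) ≤ j * j) k≡
          (packed⇒24m≤k² (length cs * suc q)
            (subst (λ m → m * suc δ ≤ n) ∣xs∣ (packing G δ≤ xs-far))))

theorem1 : Σ[ algorithm ∈ (∀ n → Graph n → List (Fin n)) ]
    (∀ n (G : Graph n) (δ : ℕ) → Connected G → IsMinDegree G δ →
    Burns G (algorithm n G) ×
    length (algorithm n G) ≤ ⌈√ (+ (24 * n) / suc δ) ⌉)
theorem1 = algorithm , correct
  where
  algorithm : ∀ n → Graph n → List (Fin n)
  algorithm n G = burningSequence G (scale (bound n (minDegree G)))

  correct : ∀ n (G : Graph n) (δ : ℕ) → Connected G → IsMinDegree G δ →
    Burns G (algorithm n G) × length (algorithm n G) ≤ bound n δ
  -- Identifies δ with the computed minimum degree, so that q is the scale used by `algorithm`.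
  correct n G δ connected isMin with refl ← minDegree-correct G isMin =
    burningSequence-burns G q ,
    ≤-trans (length-thenWait G (radius q) (net G (radius q) (allFin n)))
      (separated⇒length+radius≤k G connected isMin (net-far G (radius q) (allFin n)))
    where q = scale (bound n δ)
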